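{- The statement $OTT(\mathrm{cov}K)$ is false.
   Context: $\mathrm{cov}K$ is the least cardinal $\kappa$ such that the real line can be covered by $\kappa$ many nowhere dense sets. For a cardinal $\kappa$, $OTT(\kappa)$ is the following statement: for every finite $n>2$, every countable consistent theory $T$ in $L_n$ (first order logic restricted to the first $n$ variables) whose Tarski–Lindenbaum algebra $\mathfrak{Fm}_T$ belongs to $\mathfrak{Nr}_n\mathsf{CA}_\omega$, and every family of $\kappa$ many non-principal types of $T$, there is a model of $T$ omitting all types in the family. Here a type $\Gamma$ (a set of $L_n$ formulas) is non-principal if there is no formula $\psi$ consistent with $T$ with $T\models\psi\to\phi$ for all $\phi\in\Gamma$; a model $\mathfrak M$ omits $\Gamma$ if no assignment $s\in{}^nM$ satisfies all formulas in $\Gamma$. $\mathsf{CA}_\omega$ is the class of cylindric algebras of dimension $\omega$, and $\mathfrak{Nr}_n\mathsf{CA}_\omega$ is the class of (isomorphic copies of) neat $n$-reducts $\mathfrak{Nr}_n\mathfrak B$, $\mathfrak B\in\mathsf{CA}_\omega$, where $\mathfrak{Nr}_n\mathfrak B$ has universe $\{b:c_ib=b\text{ for all }i\ge n\}$ and the operations of $\mathfrak B$ with indices $<n$. -}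

module Defs where

open import Level using (Level; 0ℓ; _⊔_) renaming (suc to lsuc)
open import Algebra.Lattice.Bundles using (BooleanAlgebra)
open import Data.Empty using (⊥)
open import Data.Fin using (Fin; toℕ)
open import Data.Fin.Properties using (toℕ<n)
open import Data.Nat using (ℕ; _≤_; _>_)
open import Data.Nat.Properties using (<⇒≱)
open import Data.Product using (Σ; ∃; ∃-syntax; _×_; _,_; proj₁; proj₂)
open import Data.Rational using (ℚ) renaming (_<_ to _<ℚ_)
open import Data.Sum using (_⊎_)
open import Data.Vec using (Vec; lookup; map; _[_]≔_)
open import Data.Vec.Membership.Propositional using (_∈_)
open import Function.Bundles using (_↣_; _⇔_)
open import Function.Definitions using (Congruent; Bijective)
open import Relation.Binary.Core using (Rel)
open import Relation.Binary.Definitions using (_Respects_)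
open import Relation.Binary.PropositionalEquality using (_≡_; _≢_; refl)
open import Relation.Nullary using (¬_)
open import Relation.Unary using (Pred)
import Algebra.Lattice.Properties.BooleanAlgebra as BooleanProperties
import Relation.Binary.Reasoning.Setoid as SetoidReasoning

private
  variable
    a b c ℓ ℓ₁ ℓ₂ : Level

-- Real numbers as two-sided Dedekind cuts: Lower q means q < x, Upper q
-- means x < q.

record ℝ : Set₁ where
  field
    Lower Upper     : Pred ℚ 0ℓ
    lower-inhabited : ∃[ q ] Lower q
    upper-inhabited : ∃[ q ] Upper q
    lower-rounded   : ∀ q → Lower q ⇔ (∃[ r ] q <ℚ r × Lower r)
    upper-rounded   : ∀ q → Upper q ⇔ (∃[ r ] r <ℚ q × Upper r)
    disjoint        : ∀ q → ¬ (Lower q × Upper q)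
    located         : ∀ q r → q <ℚ r → Lower q ⊎ Upper r

open ℝ public using (Lower; Upper)

_≈ℝ_ : ℝ → ℝ → Set
x ≈ℝ y = (∀ q → Lower x q ⇔ Lower y q) × (∀ q → Upper x q ⇔ Upper y q)

_∈⟨_,_⟩ : ℝ → ℚ → ℚ → Set
x ∈⟨ p , q ⟩ = Lower x p × Upper x q

Closure : Pred ℝ ℓ → Pred ℝ (lsuc 0ℓ ⊔ ℓ)
Closure N x = ∀ p q → x ∈⟨ p , q ⟩ → ∃[ y ] y ∈⟨ p , q ⟩ × N y

Interior : Pred ℝ ℓ → Pred ℝ (lsuc 0ℓ ⊔ ℓ)
Interior N x = ∃[ p ] ∃[ q ] x ∈⟨ p , q ⟩ × (∀ y → y ∈⟨ p , q ⟩ → N y)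

NowhereDense : Pred ℝ ℓ → Set (lsuc 0ℓ ⊔ ℓ)
NowhereDense N = ∀ x → ¬ Interior (Closure N) x

-- Cardinals are represented by types, compared by injections; K has
-- cardinality covK when it indexes a cover and injects into every type
-- that does.

NowhereDenseCover : Set → Set₁
NowhereDenseCover K =
  Σ (K → Pred ℝ 0ℓ) λ N →
      (∀ k → N k Respects _≈ℝ_)
    × (∀ k → NowhereDense (N k))
    × (∀ x → ∃[ k ] N k x)

IsCovK : Set → Set₁
IsCovK K = NowhereDenseCover K × (∀ (J : Set) → NowhereDenseCover J → K ↣ J)

-- The similarity type of cylindric algebras whose dimension is the
-- index set I.

record RawCylindric (I : Set) c ℓ : Set (lsuc (c ⊔ ℓ)) where
  infix  8 ¬ᶜ_
  infixr 7 _∧_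
  infixr 6 _∨_
  infix  4 _≈_
  field
    Carrier : Set c
    _≈_     : Rel Carrier ℓ
    _∨_ _∧_ : Carrier → Carrier → Carrier
    ¬ᶜ_     : Carrier → Carrier
    ⊤ᶜ ⊥ᶜ   : Carrier
    cyl     : I → Carrier → Carrier
    diag    : I → I → Carrier

record CA (I : Set) c ℓ : Set (lsuc (c ⊔ ℓ)) where
  field
    booleanAlgebra : BooleanAlgebra c ℓ
  open BooleanAlgebra booleanAlgebra public renaming (¬_ to ¬ᶜ_; ⊤ to ⊤ᶜ; ⊥ to ⊥ᶜ)
  field
    cyl      : I → Carrier → Carrier
    diag     : I → I → Carrier
    cyl-cong : ∀ i {x y} → x ≈ y → cyl i x ≈ cyl i y
    cyl-⊥    : ∀ i → cyl i ⊥ᶜ ≈ ⊥ᶜ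
    -- x ≤ cᵢ x
    cyl-incr : ∀ i x → x ∧ cyl i x ≈ x
    cyl-∧    : ∀ i x y → cyl i (x ∧ cyl i y) ≈ cyl i x ∧ cyl i y
    cyl-comm : ∀ i j x → cyl i (cyl j x) ≈ cyl j (cyl i x)
    diag-refl  : ∀ i → diag i i ≈ ⊤ᶜ
    diag-trans : ∀ i j k → k ≢ i → k ≢ j →
                 diag i j ≈ cyl k (diag i k ∧ diag k j)
    diag-subst : ∀ i j x → i ≢ j →
                 cyl i (diag i j ∧ x) ∧ cyl i (diag i j ∧ ¬ᶜ x) ≈ ⊥ᶜ

record _≅_ {I : Set} (A : RawCylindric I a ℓ₁) (B : RawCylindric I b ℓ₂)
           : Set (a ⊔ ℓ₁ ⊔ b ⊔ ℓ₂) where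
  private
    module A = RawCylindric A
    module B = RawCylindric B
  field
    to        : A.Carrier → B.Carrier
    cong      : Congruent A._≈_ B._≈_ to
    bijective : Bijective A._≈_ B._≈_ to
    ∨-homo    : ∀ x y → to (x A.∨ y) B.≈ to x B.∨ to y
    ∧-homo    : ∀ x y → to (x A.∧ y) B.≈ to x B.∧ to y
    ¬-homo    : ∀ x → to (A.¬ᶜ x) B.≈ B.¬ᶜ to x
    ⊤-homo    : to A.⊤ᶜ B.≈ B.⊤ᶜ
    ⊥-homo    : to A.⊥ᶜ B.≈ B.⊥ᶜ
    cyl-homo  : ∀ i x → to (A.cyl i x) B.≈ B.cyl i (to x)
    diag-homo : ∀ i j → to (A.diag i j) B.≈ B.diag i j

module CAProperties {I : Set} (B : CA I c ℓ) where
  open CA B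
  open BooleanProperties booleanAlgebra
    using (∧-identityʳ; ∧-identityˡ; ∨-identityˡ; ¬-involutive; deMorgan₂)
  open SetoidReasoning setoid

  Fixed : I → Pred Carrier ℓ
  Fixed i x = cyl i x ≈ x

  fixed-resp : ∀ {i x y} → x ≈ y → Fixed i x → Fixed i y
  fixed-resp {i} x≈y fx = trans (cyl-cong i (sym x≈y)) (trans fx x≈y)

  fixed-⊤ : ∀ i → Fixed i ⊤ᶜ
  fixed-⊤ i = trans (sym (∧-identityˡ _)) (cyl-incr i ⊤ᶜ)

  fixed-∧ : ∀ i {x y} → Fixed i x → Fixed i y → Fixed i (x ∧ y)
  fixed-∧ i {x} {y} fx fy = begin
    cyl i (x ∧ y)        ≈⟨ cyl-cong i (∧-congˡ fy) ⟨
    cyl i (x ∧ cyl i y)  ≈⟨ cyl-∧ i x y ⟩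
    cyl i x ∧ cyl i y    ≈⟨ ∧-cong fx fy ⟩
    x ∧ y                ∎

  fixed-¬ : ∀ i {x} → Fixed i x → Fixed i (¬ᶜ x)
  fixed-¬ i {x} fx = begin
    z                      ≈⟨ ∧-identityʳ z ⟨
    z ∧ ⊤ᶜ                 ≈⟨ ∧-congˡ (∨-complementʳ x) ⟨
    z ∧ (x ∨ ¬ᶜ x)         ≈⟨ ∧-distribˡ-∨ z x (¬ᶜ x) ⟩
    (z ∧ x) ∨ (z ∧ ¬ᶜ x)   ≈⟨ ∨-cong z∧x (trans (∧-comm z _) (cyl-incr i (¬ᶜ x))) ⟩
    ⊥ᶜ ∨ ¬ᶜ x              ≈⟨ ∨-identityˡ _ ⟩
    ¬ᶜ x                   ∎
    where
    z = cyl i (¬ᶜ x)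
    z∧x : z ∧ x ≈ ⊥ᶜ
    z∧x = begin
      z ∧ x                   ≈⟨ ∧-congˡ fx ⟨
      z ∧ cyl i x             ≈⟨ cyl-∧ i (¬ᶜ x) x ⟨
      cyl i (¬ᶜ x ∧ cyl i x)  ≈⟨ cyl-cong i (∧-congˡ fx) ⟩
      cyl i (¬ᶜ x ∧ x)        ≈⟨ cyl-cong i (∧-complementˡ x) ⟩
      cyl i ⊥ᶜ                ≈⟨ cyl-⊥ i ⟩
      ⊥ᶜ                      ∎

  fixed-∨ : ∀ i {x y} → Fixed i x → Fixed i y → Fixed i (x ∨ y)
  fixed-∨ i {x} {y} fx fy =
    fixed-resp (trans (¬-cong (sym (deMorgan₂ x y))) (¬-involutive (x ∨ y)))
      (fixed-¬ i (fixed-∧ i (fixed-¬ i fx) (fixed-¬ i fy)))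

  fixed-cyl : ∀ i j {x} → Fixed i x → Fixed i (cyl j x)
  fixed-cyl i j {x} fx = trans (cyl-comm i j x) (cyl-cong j fx)

  cyl-idem : ∀ i x → Fixed i (cyl i x)
  cyl-idem i x = begin
    cyl i (cyl i x)         ≈⟨ cyl-cong i (∧-identityˡ _) ⟨
    cyl i (⊤ᶜ ∧ cyl i x)    ≈⟨ cyl-∧ i ⊤ᶜ x ⟩
    cyl i ⊤ᶜ ∧ cyl i x      ≈⟨ ∧-congʳ (fixed-⊤ i) ⟩
    ⊤ᶜ ∧ cyl i x            ≈⟨ ∧-identityˡ _ ⟩
    cyl i x                 ∎

  fixed-diag : ∀ i j k → i ≢ j → i ≢ k → Fixed i (diag j k)
  fixed-diag i j k i≢j i≢k =
    fixed-resp (sym (diag-trans j k i i≢j i≢k)) (cyl-idem i _)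

-- The neat n-reduct of an ω-dimensional algebra.

Nr : (n : ℕ) → CA ℕ c ℓ → RawCylindric (Fin n) (c ⊔ ℓ) ℓ
Nr n B = record
  { Carrier = ∃[ x ] (∀ i → n ≤ i → cyl i x ≈ x)
  ; _≈_     = λ x y → proj₁ x ≈ proj₁ y
  ; _∨_     = λ (x , fx) (y , fy) → x ∨ y , λ i n≤i → fixed-∨ i (fx i n≤i) (fy i n≤i)
  ; _∧_     = λ (x , fx) (y , fy) → x ∧ y , λ i n≤i → fixed-∧ i (fx i n≤i) (fy i n≤i)
  ; ¬ᶜ_     = λ (x , fx) → ¬ᶜ x , λ i n≤i → fixed-¬ i (fx i n≤i)
  ; ⊤ᶜ      = ⊤ᶜ , λ i _ → fixed-⊤ i
  ; ⊥ᶜ      = ⊥ᶜ , λ i _ → cyl-⊥ i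
  ; cyl     = λ j (x , fx) → cyl (toℕ j) x , λ i n≤i → fixed-cyl i (toℕ j) (fx i n≤i)
  ; diag    = λ j k → diag (toℕ j) (toℕ k) ,
                λ i n≤i → fixed-diag i (toℕ j) (toℕ k) (outside j n≤i) (outside k n≤i)
  }
  where
  open CA B
  open CAProperties B
  outside : ∀ {i} (j : Fin n) → n ≤ i → i ≢ toℕ j
  outside j n≤i refl = <⇒≱ (toℕ<n j) n≤i

_∈NrCAω : {n : ℕ} → RawCylindric (Fin n) c ℓ → Set (lsuc (c ⊔ ℓ))
_∈NrCAω {c = c} {ℓ = ℓ} {n = n} A = Σ (CA ℕ c ℓ) λ B → A ≅ Nr n B

record Signature : Set₁ where
  field
    Symbol : Set
    arity  : Symbol → ℕ

open Signature public

-- A countable signature has only countably many formulas, so every theory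
-- in it is countable.

Countable : Signature → Set
Countable S = Symbol S ↣ ℕ

infix  8 _≐_
infixr 7 _∧′_
infixr 6 _∨′_
infixr 5 _⇒′_

-- First order formulas with equality in the variables x₀, …, xₙ₋₁.

data Formula (S : Signature) (n : ℕ) : Set where
  rel             : (R : Symbol S) → Vec (Fin n) (arity S R) → Formula S n
  _≐_             : Fin n → Fin n → Formula S n
  ⊥′              : Formula S n
  _∧′_ _∨′_ _⇒′_  : Formula S n → Formula S n → Formula S n
  ∃′ ∀′           : Fin n → Formula S n → Formula S n

record Structure (S : Signature) : Set₁ where
  field
    Universe : Set
    nonempty : Universe
    interp   : (R : Symbol S) → Pred (Vec Universe (arity S R)) 0ℓ

open Structure public using (Universe)

module _ {S : Signature} {n : ℕ} where

  ¬′_ : Formula S n → Formula S n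
  ¬′ φ = φ ⇒′ ⊥′

  ⊤′ : Formula S n
  ⊤′ = ¬′ ⊥′

  _⇔′_ : Formula S n → Formula S n → Formula S n
  φ ⇔′ ψ = (φ ⇒′ ψ) ∧′ (ψ ⇒′ φ)

  Free : Fin n → Formula S n → Set
  Free i (rel R xs) = i ∈ xs
  Free i (j ≐ k)    = i ≡ j ⊎ i ≡ k
  Free i ⊥′         = ⊥
  Free i (φ ∧′ ψ)   = Free i φ ⊎ Free i ψ
  Free i (φ ∨′ ψ)   = Free i φ ⊎ Free i ψ
  Free i (φ ⇒′ ψ)   = Free i φ ⊎ Free i ψ
  Free i (∃′ j φ)   = i ≢ j × Free i φ
  Free i (∀′ j φ)   = i ≢ j × Free i φ

  Sentence : Pred (Formula S n) 0ℓ
  Sentence φ = ∀ i → ¬ Free i φ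

  _,_⊩_ : (M : Structure S) → Vec (Universe M) n → Formula S n → Set
  M , s ⊩ rel R xs = Structure.interp M R (map (lookup s) xs)
  M , s ⊩ (j ≐ k)  = lookup s j ≡ lookup s k
  M , s ⊩ ⊥′       = ⊥
  M , s ⊩ (φ ∧′ ψ) = (M , s ⊩ φ) × (M , s ⊩ ψ)
  M , s ⊩ (φ ∨′ ψ) = (M , s ⊩ φ) ⊎ (M , s ⊩ ψ)
  M , s ⊩ (φ ⇒′ ψ) = M , s ⊩ φ → M , s ⊩ ψ
  M , s ⊩ ∃′ j φ   = ∃[ u ] M , s [ j ]≔ u ⊩ φ
  M , s ⊩ ∀′ j φ   = ∀ u → M , s [ j ]≔ u ⊩ φ

record Theory (S : Signature) (n : ℕ) : Set₁ where
  field
    Axiom    : Pred (Formula S n) 0ℓ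
    sentence : ∀ φ → Axiom φ → Sentence φ

module _ {S : Signature} {n : ℕ} (T : Theory S n) where

  IsModel : Structure S → Set
  IsModel M = ∀ φ → Theory.Axiom T φ → ∀ s → M , s ⊩ φ

  Entails : Formula S n → Set₁
  Entails φ = ∀ M → IsModel M → ∀ s → M , s ⊩ φ

  Consistent : Set₁
  Consistent = ¬ Entails ⊥′

  ConsistentWith : Formula S n → Set₁
  ConsistentWith ψ = ¬ Entails (¬′ ψ)

  -- The Tarski–Lindenbaum algebra, as a setoid: formulas modulo T-equivalence.

  Fm : RawCylindric (Fin n) 0ℓ (lsuc 0ℓ)
  Fm = record
    { Carrier = Formula S n
    ; _≈_     = λ φ ψ → Entails (φ ⇔′ ψ)
    ; _∨_     = _∨′_
    ; _∧_     = _∧′_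
    ; ¬ᶜ_     = ¬′_
    ; ⊤ᶜ      = ⊤′
    ; ⊥ᶜ      = ⊥′
    ; cyl     = ∃′
    ; diag    = _≐_
    }

  NonPrincipal : Pred (Formula S n) 0ℓ → Set₁
  NonPrincipal Γ = ¬ (∃[ ψ ] ConsistentWith ψ × (∀ φ → Γ φ → Entails (ψ ⇒′ φ)))

Omits : {S : Signature} {n : ℕ} → Structure S → Pred (Formula S n) 0ℓ → Set
Omits M Γ = ¬ (∃[ s ] (∀ φ → Γ φ → M , s ⊩ φ))

OTT : Set → Set₂
OTT K =
  ∀ (n : ℕ) → n > 2 →
  ∀ (S : Signature) → Countable S →
  ∀ (T : Theory S n) → Consistent T → Fm T ∈NrCAω →
  ∀ (Γ : K → Pred (Formula S n) 0ℓ) → (∀ k → NonPrincipal T (Γ k)) →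
  ∃[ M ] IsModel T M × (∀ k → Omits M (Γ k))

{-# OPTIONS --safe #-}
module Submission where

-- Why OTT fails at any K indexing a cover of the line by nowhere dense sets.
--
-- Take the theory with one propositional symbol P_q for each rational q whose
-- axioms say that {q : P_q} is a downward closed set containing 0 but not 1,
-- and that the universe has at most one element.  Up to isomorphism and the
-- choice of an endpoint, a model is a real number in [0,1], the point x(M) at
-- which the truth of P_q changes.
--
-- On one-element universes cylindrifications do nothing and diagonals are
-- everything.  The formula algebra is therefore a Boolean algebra with
-- identity cylindrifiers and top diagonals.  The same prescription
-- in dimension omega gives a cylindric algebra all of whose elements are fixed
-- by every cylindrifier, so it is its own neat n-reduct (fm-neat).
--
-- Given nowhere dense sets N_k covering the line, let Γ_k be the set of
-- formulas valid in all models M with x(M) in N_k.  The point x(M) of any model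
-- lies in some N_k, so M realizes that Γ_k: no model omits all of them.
--
-- Each Γ_k is non-principal.  A formula ψ mentions finitely many symbols,
-- hence if ψ is true in some model then, for some rationals a < b, it is true
-- in all models where P_a holds and P_b fails (locality).  If ψ
-- implied all of Γ_k, then N_k would be dense in (a,b): an interval around u < v
-- in (a,b) missing N_k makes "not (P_u and not P_v)" a member of Γ_k, yet
-- the cut at u is a model of ψ refuting it (principal⇒dense).

open import Defs
open import Axiom.ExcludedMiddle using (ExcludedMiddle)
open import Relation.Nullary using (¬_)

open import Level using (0ℓ) renaming (suc to lsuc)
open import Algebra.Lattice.Bundles using (BooleanAlgebra)
open import Algebra.Lattice.Structures.Biased using (isBooleanAlgebraʳ; isDistributiveLatticeʳʲᵐ)
open import Data.Empty using (⊥-elim)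
open import Data.Fin using (Fin; zero; suc)
open import Data.Integer using (ℤ; +_; -[1+_])
open import Data.Nat as ℕ using (ℕ; z≤n; s≤s)
import Data.Nat.Properties as ℕ
open import Data.Product as Product using (∃-syntax; _×_; _,_; proj₁; proj₂; swap; assocʳ′; assocˡ′)
open import Data.Product.Function.NonDependent.Propositional using (_×-⇔_)
open import Data.Rational using (ℚ; mkℚ; 0ℚ; 1ℚ; -_; _+_; _⊔_; _⊓_; _≤_; _<_)
open import Data.Rational.Properties
open import Data.Sum as Sum using (_⊎_; inj₁; inj₂; [_,_])
open import Data.Sum.Function.Propositional using (_⊎-⇔_)
open import Data.Unit using (⊤; tt)
open import Data.Vec using (Vec; []; _∷_; replicate; _[_]≔_; lookup)
open import Function.Base using (id; _∘_)
open import Function.Bundles using (_⇔_; mk↣; mk⇔; Equivalence)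
open import Function.Related.TypeIsomorphisms using (→-cong-⇔)
open import Relation.Binary.PropositionalEquality using (_≡_; refl; sym; cong; cong₂; subst)
open import Relation.Nullary using (yes; no; contradiction)
open import Relation.Nullary.Decidable using (True; toWitness; fromWitness; from-yes)
open import Relation.Unary using (Pred)

-- The rationals as a countable set of symbols

-- The number 2^i (2 j + 1).
pair : ℕ → ℕ → ℕ
pair ℕ.zero    j = ℕ.suc (2 ℕ.* j)
pair (ℕ.suc i) j = 2 ℕ.* pair i j

pair-injective : ∀ i i′ {j j′} → pair i j ≡ pair i′ j′ → i ≡ i′ × j ≡ j′
pair-injective ℕ.zero ℕ.zero eq =
  refl , ℕ.*-cancelˡ-≡ _ _ 2 (ℕ.suc-injective eq)
pair-injective ℕ.zero (ℕ.suc i′) {j} {j′} eq =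
  contradiction (sym eq) (ℕ.even≢odd (pair i′ j′) j)
pair-injective (ℕ.suc i) ℕ.zero {j} {j′} eq =
  contradiction eq (ℕ.even≢odd (pair i j) j′)
pair-injective (ℕ.suc i) (ℕ.suc i′) eq =
  Product.map₁ (cong ℕ.suc) (pair-injective i i′ (ℕ.*-cancelˡ-≡ _ _ 2 eq))

codeℤ : ℤ → ℕ
codeℤ (+ m)    = 2 ℕ.* m
codeℤ -[1+ m ] = ℕ.suc (2 ℕ.* m)

codeℤ-injective : ∀ i j → codeℤ i ≡ codeℤ j → i ≡ j
codeℤ-injective (+ m)    (+ n)    eq = cong +_ (ℕ.*-cancelˡ-≡ m n 2 eq)
codeℤ-injective (+ m)    -[1+ n ] eq = contradiction eq (ℕ.even≢odd m n)
codeℤ-injective -[1+ m ] (+ n)    eq = contradiction (sym eq) (ℕ.even≢odd n m)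
codeℤ-injective -[1+ m ] -[1+ n ] eq = cong -[1+_] (ℕ.*-cancelˡ-≡ m n 2 (ℕ.suc-injective eq))

codeℚ : ℚ → ℕ
codeℚ (mkℚ i d _) = pair (codeℤ i) d

codeℚ-injective : ∀ {p q} → codeℚ p ≡ codeℚ q → p ≡ q
codeℚ-injective {mkℚ i _ _} {mkℚ j _ _} eq =
  let codes≡ , d≡e = pair-injective (codeℤ i) (codeℤ j) eq
  in mkℚ-cong (codeℤ-injective i j codes≡) d≡e

-- Formula algebras of theories of one-element structures

vec-subsingleton : ∀ {A : Set} → (∀ (x y : A) → x ≡ y) →
                   ∀ {n} (s t : Vec A n) → s ≡ t
vec-subsingleton A-prop []      []      = refl
vec-subsingleton A-prop (x ∷ s) (y ∷ t) = cong₂ _∷_ (A-prop x y) (vec-subsingleton A-prop s t)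

module SubsingletonTheory
  (em : ∀ {ℓ} → ExcludedMiddle ℓ) {S : Signature} {n : ℕ} (T : Theory S n)
  (subsingleton : ∀ M → IsModel T M → ∀ (u v : Universe M) → u ≡ v)
  where

  private
    _≈T_ : Formula S n → Formula S n → Set₁
    φ ≈T ψ = Entails T (φ ⇔′ ψ)

    ≈T-refl : ∀ {φ} → φ ≈T φ
    ≈T-refl M _ s = id , id

  lindenbaum : BooleanAlgebra 0ℓ (lsuc 0ℓ)
  lindenbaum = record
    { Carrier = Formula S n
    ; _≈_     = _≈T_
    ; _∨_     = _∨′_
    ; _∧_     = _∧′_
    ; ¬_      = ¬′_
    ; ⊤       = ⊤′
    ; ⊥       = ⊥′
    ; isBooleanAlgebra = isBooleanAlgebraʳ record
      { isDistributiveLattice = isDistributiveLatticeʳʲᵐ record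
        { isLattice = record
          { isEquivalence = record
            { refl  = λ {φ} → ≈T-refl {φ}
            ; sym   = λ p M m s → swap (p M m s)
            ; trans = λ p q M m s →
                proj₁ (q M m s) ∘ proj₁ (p M m s) , proj₂ (p M m s) ∘ proj₂ (q M m s)
            }
          ; ∨-comm  = λ φ ψ M m s → Sum.swap , Sum.swap
          ; ∨-assoc = λ φ ψ χ M m s → Sum.assocʳ , Sum.assocˡ
          ; ∨-cong  = λ p q M m s →
              Sum.map (proj₁ (p M m s)) (proj₁ (q M m s)) ,
              Sum.map (proj₂ (p M m s)) (proj₂ (q M m s))
          ; ∧-comm  = λ φ ψ M m s → swap , swap
          ; ∧-assoc = λ φ ψ χ M m s → assocʳ′ , assocˡ′
          ; ∧-cong  = λ p q M m s →
              Product.map (proj₁ (p M m s)) (proj₁ (q M m s)) ,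
              Product.map (proj₂ (p M m s)) (proj₂ (q M m s))
          ; absorptive =
              (λ φ ψ M m s → [ id , proj₁ ] , inj₁) ,
              (λ φ ψ M m s → proj₁ , λ h → h , inj₁ h)
          }
        ; ∨-distribʳ-∧ = λ φ ψ χ M m s →
            [ (λ (h , k) → inj₁ h , inj₁ k) , (λ h → inj₂ h , inj₂ h) ] ,
            λ { (inj₁ h , inj₁ k) → inj₁ (h , k)
              ; (inj₂ h , _)      → inj₂ h
              ; (_ , inj₂ k)      → inj₂ k }
        }
      ; ∨-complementʳ = λ φ M m s → (λ _ → id) , λ _ → excludedMiddle (M , s ⊩ φ)
      ; ∧-complementʳ = λ φ M m s → (λ (h , ¬h) → ¬h h) , ⊥-elim
      ; ¬-cong = λ p M m s → (λ ¬h → ¬h ∘ proj₂ (p M m s)) , (λ ¬h → ¬h ∘ proj₁ (p M m s))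
      }
    }
    where
    excludedMiddle : (P : Set) → P ⊎ ¬ P
    excludedMiddle P with em {P = P}
    ... | yes h = inj₁ h
    ... | no ¬h = inj₂ ¬h

  -- Identity cylindrifiers and top diagonals make any Boolean algebra
  -- cylindric, in any dimension.
  discrete : CA ℕ 0ℓ (lsuc 0ℓ)
  discrete = record
    { booleanAlgebra = lindenbaum
    ; cyl        = λ _ φ → φ
    ; diag       = λ _ _ → ⊤′
    ; cyl-cong   = λ _ p → p
    ; cyl-⊥      = λ _ → ≈T-refl {⊥′}
    ; cyl-incr   = λ _ φ M m s → proj₁ , λ h → h , h
    ; cyl-∧      = λ _ φ ψ → ≈T-refl {φ ∧′ ψ}
    ; cyl-comm   = λ _ _ φ → ≈T-refl {φ}
    ; diag-refl  = λ _ → ≈T-refl {⊤′}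
    ; diag-trans = λ _ _ _ _ _ M m s → (λ h → h , h) , proj₁
    ; diag-subst = λ _ _ φ _ M m s → (λ ((_ , h) , (_ , ¬h)) → ¬h h) , ⊥-elim
    }

  fm-neat : Fm T ∈NrCAω
  fm-neat = discrete , record
    { to        = λ φ → φ , λ _ _ → ≈T-refl {φ}
    ; cong      = id
    ; bijective = id , λ (ψ , _) → ψ , id
    ; ∨-homo    = λ φ ψ → ≈T-refl {φ ∨′ ψ}
    ; ∧-homo    = λ φ ψ → ≈T-refl {φ ∧′ ψ}
    ; ¬-homo    = λ φ → ≈T-refl {¬′ φ}
    ; ⊤-homo    = ≈T-refl {⊤′}
    ; ⊥-homo    = ≈T-refl {⊥′}
    ; cyl-homo  = λ i φ M m s →
        (λ (u , h) → transport φ M m (s [ i ]≔ u) s h) ,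
        (λ h → lookup s i , transport φ M m s (s [ i ]≔ lookup s i) h)
    ; diag-homo = λ i j M m s → (λ _ → id) , λ _ → subsingleton M m _ _
    }
    where
    transport : ∀ φ M → IsModel T M → ∀ s t → M , s ⊩ φ → M , t ⊩ φ
    transport φ M m s t = subst (M ,_⊩ φ) (vec-subsingleton (subsingleton M m) s t)

-- The theory of cuts in the unit interval

cutSignature : Signature
cutSignature = record { Symbol = ℚ ; arity = λ _ → 0 }

P : ∀ {n} → ℚ → Formula cutSignature n
P q = rel q []

module _ {n : ℕ} where

  private
    x₀ x₁ : Fin (2 ℕ.+ n)
    x₀ = zero
    x₁ = suc zero

  data CutAxiom : Pred (Formula cutSignature (2 ℕ.+ n)) 0ℓ where
    one-element : CutAxiom (∀′ x₀ (∀′ x₁ (x₀ ≐ x₁)))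
    downward    : ∀ {p q} → p ≤ q → CutAxiom (P q ⇒′ P p)
    above-0     : CutAxiom (P 0ℚ)
    below-1     : CutAxiom (¬′ P 1ℚ)

  cutAxiom-sentence : ∀ φ → CutAxiom φ → Sentence φ
  cutAxiom-sentence _ one-element  i (i≢x₀ , i≢x₁ , inj₁ i≡x₀) = i≢x₀ i≡x₀
  cutAxiom-sentence _ one-element  i (i≢x₀ , i≢x₁ , inj₂ i≡x₁) = i≢x₁ i≡x₁
  cutAxiom-sentence _ (downward _) i (inj₁ ())
  cutAxiom-sentence _ (downward _) i (inj₂ ())
  cutAxiom-sentence _ above-0      i ()
  cutAxiom-sentence _ below-1      i (inj₁ ())
  cutAxiom-sentence _ below-1      i (inj₂ ())

cutTheory : ∀ n → Theory cutSignature (2 ℕ.+ n)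
cutTheory n = record { Axiom = CutAxiom ; sentence = cutAxiom-sentence }

⊔-preserves : ∀ (Q : Pred ℚ 0ℓ) {a b} → Q a → Q b → Q (a ⊔ b)
⊔-preserves Q {a} {b} Qa Qb with ⊔-sel a b
... | inj₁ a⊔b≡a = subst Q (sym a⊔b≡a) Qa
... | inj₂ a⊔b≡b = subst Q (sym a⊔b≡b) Qb

⊓-preserves : ∀ (Q : Pred ℚ 0ℓ) {a b} → Q a → Q b → Q (a ⊓ b)
⊓-preserves Q {a} {b} Qa Qb with ⊓-sel a b
... | inj₁ a⊓b≡a = subst Q (sym a⊓b≡a) Qa
... | inj₂ a⊓b≡b = subst Q (sym a⊓b≡b) Qb

Holds : Structure cutSignature → ℚ → Set
Holds M q = Structure.interp M q []

-- Basic clopen neighbourhoods in the space of cuts.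
Straddles : Structure cutSignature → ℚ → ℚ → Set
Straddles M a b = Holds M a × ¬ Holds M b

straddles-⊔-⊓ : ∀ M {a b c d} → Straddles M a b → Straddles M c d →
                Straddles M (a ⊔ c) (b ⊓ d)
straddles-⊔-⊓ M (ha , ¬hb) (hc , ¬hd) =
  ⊔-preserves (Holds M) ha hc , ⊓-preserves (¬_ ∘ Holds M) ¬hb ¬hd

cutAt : ℚ → Structure cutSignature
cutAt c = record { Universe = ⊤ ; nonempty = tt ; interp = λ q _ → q ≤ c }

cutAt-straddles : ∀ {a b c} → a ≤ c → c < b → Straddles (cutAt c) a b
cutAt-straddles a≤c c<b = a≤c , λ b≤c → <-irrefl refl (<-≤-trans c<b b≤c)

∈-intersect : ∀ x {p q p′ q′} → x ∈⟨ p , q ⟩ → x ∈⟨ p′ , q′ ⟩ → x ∈⟨ p ⊔ p′ , q ⊓ q′ ⟩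
∈-intersect x (p<x , x<q) (p′<x , x<q′) =
  ⊔-preserves (Lower x) p<x p′<x , ⊓-preserves (Upper x) x<q x<q′

∈-< : ∀ x {p q} → x ∈⟨ p , q ⟩ → p < q
∈-< x {p} {q} (p<x , x<q) = ≰⇒> λ q≤p →
  let r , p<r , r<x = Equivalence.to (ℝ.lower-rounded x p) p<x
  in ℝ.disjoint x q (Equivalence.from (ℝ.lower-rounded x q) (r , ≤-<-trans q≤p p<r , r<x) , x<q)

module Cuts (em : ∀ {ℓ} → ExcludedMiddle ℓ) (n : ℕ) where

  T : Theory cutSignature (2 ℕ.+ n)
  T = cutTheory n

  cutAt-model : ∀ {c} → 0ℚ ≤ c → c < 1ℚ → IsModel T (cutAt c)
  cutAt-model 0≤c c<1 _ one-element    s     = λ _ _ → refl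
  cutAt-model 0≤c c<1 _ (downward p≤q) s     = ≤-trans p≤q
  cutAt-model 0≤c c<1 _ above-0        s     = 0≤c
  cutAt-model 0≤c c<1 _ below-1        s     = proj₂ (cutAt-straddles 0≤c c<1)

  0<1 : 0ℚ < 1ℚ
  0<1 = from-yes (0ℚ <? 1ℚ)

  consistent : Consistent T
  consistent ⊨⊥ = ⊨⊥ (cutAt 0ℚ) (cutAt-model ≤-refl 0<1) (replicate _ tt)

  module Model {M : Structure cutSignature} (M⊨T : IsModel T M) where

    someAssignment : Vec (Universe M) (2 ℕ.+ n)
    someAssignment = replicate _ (Structure.nonempty M)

    subsingleton : ∀ (u v : Universe M) → u ≡ v
    subsingleton u v = M⊨T _ one-element (u ∷ v ∷ replicate n u) u v

    holds-≤ : ∀ {p q} → p ≤ q → Holds M q → Holds M p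
    holds-≤ p≤q = M⊨T _ (downward p≤q) someAssignment

    holds-0 : Holds M 0ℚ
    holds-0 = M⊨T _ above-0 someAssignment

    ¬holds-1 : ¬ Holds M 1ℚ
    ¬holds-1 = M⊨T _ below-1 someAssignment

    straddles-0-1 : Straddles M 0ℚ 1ℚ
    straddles-0-1 = holds-0 , ¬holds-1

    straddles-< : ∀ {a b} → Straddles M a b → a < b
    straddles-< (ha , ¬hb) = ≰⇒> λ b≤a → ¬hb (holds-≤ b≤a ha)

    straddles-widen : ∀ {a a′ b b′} → a ≤ a′ → b′ ≤ b → Straddles M a′ b′ → Straddles M a b
    straddles-widen a≤a′ b′≤b (ha′ , ¬hb′) = holds-≤ a≤a′ ha′ , ¬hb′ ∘ holds-≤ b′≤b

    -- The point is insensitive to the truth of P at the point itself, since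
    -- both cuts are taken strictly inside.
    point : ℝ
    point = record
      { Lower = λ q → ∃[ r ] q < r × Holds M r
      ; Upper = λ q → ∃[ r ] r < q × ¬ Holds M r
      ; lower-inhabited = - 1ℚ , 0ℚ , from-yes (- 1ℚ <? 0ℚ) , holds-0
      ; upper-inhabited = 1ℚ + 1ℚ , 1ℚ , from-yes (1ℚ <? 1ℚ + 1ℚ) , ¬holds-1
      ; lower-rounded = λ q → mk⇔
          (λ (r , q<r , hr) → let m , q<m , m<r = <-dense q<r in m , q<m , r , m<r , hr)
          (λ (r , q<r , t , r<t , ht) → t , <-trans q<r r<t , ht)
      ; upper-rounded = λ q → mk⇔
          (λ (r , r<q , ¬hr) → let m , r<m , m<q = <-dense r<q in m , m<q , r , r<m , ¬hr)
          (λ (r , r<q , t , t<r , ¬ht) → t , <-trans t<r r<q , ¬ht)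
      ; disjoint = λ q ((r , q<r , hr) , (t , t<q , ¬ht)) →
          ¬ht (holds-≤ (<⇒≤ (<-trans t<q q<r)) hr)
      ; located = located
      }
      where
      located : ∀ q r → q < r →
                (∃[ t ] q < t × Holds M t) ⊎ (∃[ t ] t < r × ¬ Holds M t)
      located q r q<r with m , q<m , m<r ← <-dense q<r | em {P = Holds M m}
      ... | yes hm = inj₁ (m , q<m , hm)
      ... | no ¬hm = inj₂ (m , m<r , ¬hm)

    point-∈ : ∀ {p q u v} → p < u → v < q → Straddles M u v → point ∈⟨ p , q ⟩
    point-∈ p<u v<q (hu , ¬hv) = (_ , p<u , hu) , (_ , v<q , ¬hv)

  open Model

  fm-neat : Fm T ∈NrCAω
  fm-neat = SubsingletonTheory.fm-neat em T (λ M m → subsingleton m)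

-- Formulas depend on the cut only locally

  Determines : (M : Structure cutSignature) → ℚ → ℚ → Formula cutSignature (2 ℕ.+ n) → Set₁
  Determines M a b φ = ∀ {M′} → IsModel T M′ → Straddles M′ a b →
                       ∀ s s′ → (M , s ⊩ φ) ⇔ (M′ , s′ ⊩ φ)

  -- A formula mentions finitely many symbols: let a be the largest of these
  -- that M makes true, or 0, and b the smallest that it makes false, or 1.
  -- Assignments do not matter because universes have one element.
  locality : ∀ {M} → IsModel T M → ∀ φ →
             ∃[ a ] ∃[ b ] Straddles M a b × Determines M a b φ
  locality-binary :
    ∀ {M} → IsModel T M → ∀ φ ψ χ →
    (∀ {M′} s s′ → (M , s ⊩ φ) ⇔ (M′ , s′ ⊩ φ) → (M , s ⊩ ψ) ⇔ (M′ , s′ ⊩ ψ) →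
                   (M , s ⊩ χ) ⇔ (M′ , s′ ⊩ χ)) →
    ∃[ a ] ∃[ b ] Straddles M a b × Determines M a b χ

  locality-binary {M} M⊨T φ ψ χ combine
    with a , b , M∈ab , φ-det ← locality M⊨T φ
       | c , d , M∈cd , ψ-det ← locality M⊨T ψ
       = a ⊔ c , b ⊓ d , straddles-⊔-⊓ M M∈ab M∈cd , λ M′⊨T M′∈ s s′ →
         combine s s′
           (φ-det M′⊨T (straddles-widen M′⊨T (p≤p⊔q a c) (p⊓q≤p b d) M′∈) s s′)
           (ψ-det M′⊨T (straddles-widen M′⊨T (p≤q⊔p a c) (p⊓q≤q b d) M′∈) s s′)

  locality {M} M⊨T (rel q []) with em {P = Holds M q}
  ... | yes hq = q , 1ℚ , (hq , ¬holds-1 M⊨T) ,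
                 λ _ (h′q , _) _ _ → mk⇔ (λ _ → h′q) (λ _ → hq)
  ... | no ¬hq = 0ℚ , q , (holds-0 M⊨T , ¬hq) ,
                 λ _ (_ , ¬h′q) _ _ → mk⇔ (⊥-elim ∘ ¬hq) (⊥-elim ∘ ¬h′q)
  locality M⊨T (i ≐ j) = 0ℚ , 1ℚ , straddles-0-1 M⊨T , λ M′⊨T _ s s′ →
    mk⇔ (λ _ → subsingleton M′⊨T _ _) (λ _ → subsingleton M⊨T _ _)
  locality M⊨T ⊥′ = 0ℚ , 1ℚ , straddles-0-1 M⊨T , λ _ _ _ _ → mk⇔ id id
  locality M⊨T (φ ∧′ ψ) = locality-binary M⊨T φ ψ (φ ∧′ ψ) λ _ _ → _×-⇔_
  locality M⊨T (φ ∨′ ψ) = locality-binary M⊨T φ ψ (φ ∨′ ψ) λ _ _ → _⊎-⇔_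
  locality M⊨T (φ ⇒′ ψ) = locality-binary M⊨T φ ψ (φ ⇒′ ψ) λ _ _ → →-cong-⇔
  locality {M} M⊨T (∃′ i φ) with a , b , M∈ab , φ-det ← locality M⊨T φ
    = a , b , M∈ab , λ {M′} M′⊨T M′∈ab s s′ →
      let e = λ u u′ → φ-det M′⊨T M′∈ab (s [ i ]≔ u) (s′ [ i ]≔ u′) in
      mk⇔ (λ (u , h) → Structure.nonempty M′ , Equivalence.to (e u _) h)
          (λ (u′ , h) → Structure.nonempty M , Equivalence.from (e _ u′) h)
  locality {M} M⊨T (∀′ i φ) with a , b , M∈ab , φ-det ← locality M⊨T φ
    = a , b , M∈ab , λ {M′} M′⊨T M′∈ab s s′ →
      let e = λ u u′ → φ-det M′⊨T M′∈ab (s [ i ]≔ u) (s′ [ i ]≔ u′) in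
      mk⇔ (λ h u′ → Equivalence.to (e _ u′) (h (Structure.nonempty M)))
          (λ h u → Equivalence.from (e u _) (h (Structure.nonempty M′)))

  -- Clipping to the unit interval makes every cut of [a,b) a model.
  true-near : ∀ {M} → IsModel T M → ∀ ψ s → M , s ⊩ ψ →
              ∃[ a ] ∃[ b ] 0ℚ ≤ a × a < b × b ≤ 1ℚ ×
                (∀ c → a ≤ c → c < b → ∀ t → cutAt c , t ⊩ ψ)
  true-near {M} M⊨T ψ s ψ-true with a , b , M∈ab , det ← locality M⊨T ψ
    = a ⊔ 0ℚ , b ⊓ 1ℚ , p≤q⊔p a 0ℚ ,
      straddles-< M⊨T (straddles-⊔-⊓ M M∈ab (straddles-0-1 M⊨T)) ,
      p⊓q≤q b 1ℚ , λ c a⊔0≤c c<b⊓1 t →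
        Equivalence.to
          (det (cutAt-model (≤-trans (p≤q⊔p a 0ℚ) a⊔0≤c) (<-≤-trans c<b⊓1 (p⊓q≤q b 1ℚ)))
               (cutAt-straddles (≤-trans (p≤p⊔q a 0ℚ) a⊔0≤c) (<-≤-trans c<b⊓1 (p⊓q≤p b 1ℚ)))
               s t)
          ψ-true

-- The type of a set of reals

  -- Validity in a class of models is a proposition of Set₁, while a type is
  -- Set-valued: excluded middle replaces the proposition by its truth value.
  TypeOf : Pred ℝ 0ℓ → Pred (Formula cutSignature (2 ℕ.+ n)) 0ℓ
  TypeOf N φ = True (em {P = ∀ M (M⊨T : IsModel T M) → N (point M⊨T) → ∀ s → M , s ⊩ φ})

  -- If N missed (p,q), choose u < v in (a,b) and (p,q).  A model with point in
  -- N cannot satisfy P u and refute P v, but the model of ψ cut at u does.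
  principal⇒dense :
    ∀ N ψ {a b} → 0ℚ ≤ a → b ≤ 1ℚ → (∀ c → a ≤ c → c < b → ∀ t → cutAt c , t ⊩ ψ) →
    (∀ φ → TypeOf N φ → Entails T (ψ ⇒′ φ)) →
    ∀ y → y ∈⟨ a , b ⟩ → Closure N y
  principal⇒dense N ψ {a} {b} 0≤a b≤1 ψ-true ψ⇒N y y∈ab p q y∈pq
    with em {P = ∃[ z ] z ∈⟨ p , q ⟩ × N z}
  ... | yes meets = meets
  ... | no  misses
    with u , a⊔p<u , u<b⊓q ← <-dense (∈-< y (∈-intersect y y∈ab y∈pq))
    with v , u<v , v<b⊓q ← <-dense u<b⊓q
    = ⊥-elim (ψ⇒N avoids avoids∈N (cutAt u) cut⊨T t (ψ-true u a≤u u<b t)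
                  (cutAt-straddles ≤-refl u<v))
    where
    avoids : Formula cutSignature (2 ℕ.+ n)
    avoids = ¬′ (P u ∧′ ¬′ P v)
    avoids∈N : TypeOf N avoids
    avoids∈N = fromWitness λ M M⊨T x∈N s M∈uv →
      misses (point M⊨T ,
              point-∈ M⊨T (≤-<-trans (p≤q⊔p a p) a⊔p<u) (<-≤-trans v<b⊓q (p⊓q≤q b q)) M∈uv ,
              x∈N)
    a≤u : a ≤ u
    a≤u = <⇒≤ (≤-<-trans (p≤p⊔q a p) a⊔p<u)
    u<b : u < b
    u<b = <-≤-trans u<b⊓q (p⊓q≤p b q)
    cut⊨T : IsModel T (cutAt u)
    cut⊨T = cutAt-model (≤-trans 0≤a a≤u) (<-≤-trans u<b b≤1)
    t : Vec ⊤ (2 ℕ.+ n)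
    t = replicate _ tt

  nowhereDense⇒nonPrincipal : ∀ N → NowhereDense N → NonPrincipal T (TypeOf N)
  nowhereDense⇒nonPrincipal N N-nwd (ψ , ψ-consistent , ψ⇒N) =
    ψ-consistent λ M M⊨T s ψ-true →
      let a , b , 0≤a , a<b , b≤1 , near = true-near M⊨T ψ s ψ-true
          -- Any real strictly between a and b serves as an interior point;
          -- two rationals c < d inside (a,b) locate the cut at c there.
          c , a<c , c<b = <-dense a<b
          d , c<d , d<b = <-dense c<b
          c⊨T = cutAt-model (≤-trans 0≤a (<⇒≤ a<c)) (<-≤-trans c<b b≤1)
      in N-nwd (point c⊨T)
           (a , b , point-∈ c⊨T a<c d<b (cutAt-straddles ≤-refl c<d) ,
            principal⇒dense N ψ 0≤a b≤1 near ψ⇒N)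

  realizes : ∀ N {M} (M⊨T : IsModel T M) → N (point M⊨T) → ¬ Omits M (TypeOf N)
  realizes N {M} M⊨T x∈N omits =
    omits (someAssignment M⊨T , λ φ φ∈N → toWitness φ∈N M M⊨T x∈N _)

theorem5p18 : (∀ {ℓ} → ExcludedMiddle ℓ) →
    ∀ (K : Set) → IsCovK K → ¬ OTT K
theorem5p18 em K ((N , _ , N-nwd , N-covers) , _) ott =
  let M , M⊨T , omits = ott 3 (s≤s (s≤s (s≤s z≤n))) cutSignature (mk↣ codeℚ-injective)
                            T consistent fm-neat
                            (λ k → TypeOf (N k)) (λ k → nowhereDense⇒nonPrincipal (N k) (N-nwd k))
      k , x∈Nk = N-covers (Model.point M⊨T)
  in realizes (N k) M⊨T x∈Nk (omits k)
  where open Cuts em 1
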